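{- $[\mathcal{R}\mathbf{Txt}\mathbf{It}\mathbf{CInd}\mathbf{Ex}_C]_{\mathbf{REC}} \subsetneq [\mathbf{Txt}\mathbf{It}\mathbf{CInd}\mathbf{Ex}_C]_{\mathbf{REC}}$.
   Context: Fix an acceptable numbering $(\varphi_e)_{e\in\mathbb{N}}$ of all partial computable functions. A number $e$ is a $C$-index if $\varphi_e$ is total with values in $\{0,1\}$; then $C_e=\{x:\varphi_e(x)=1\}$. $\mathbf{REC}$ is the collection of recursive subsets of $\mathbb{N}$; $\mathcal{P}$ and $\mathcal{R}$ are the partial computable and total computable functions. Fix a pause symbol $\#$. A text is a total function $T:\mathbb{N}\to\mathbb{N}\cup\{\#\}$, $\mathrm{content}(T)=\mathrm{range}(T)\setminus\{\#\}$, $T$ is a text for $L$ if $\mathrm{content}(T)=L$. A learner is some $h\in\mathcal{P}$. Iterative hypothesis sequence: $\mathbf{It}(h,T)(0)=h(\varepsilon)$ ($\varepsilon$ the empty sequence) and $\mathbf{It}(h,T)(i)=h(\mathbf{It}(h,T)(i-1),T(i-1))$ for $i>0$. Restrictions on a hypothesis sequence $p$ and text $T$: $\mathbf{Ex}_C$: there is $n_0$ with $p(n)=p(n_0)$ for all $n\ge n_0$ and $p(n_0)$ a $C$-index with $C_{p(n_0)}=\mathrm{content}(T)$; $\mathbf{CInd}$: for all $i$, $p(i)$ is a $C$-index. Juxtaposition means conjunction. For $\mathcal{C}\in\{\mathcal{P},\mathcal{R}\}$ (omitted means $\mathcal{P}$), $h\in\mathcal{C}$ $\mathcal{C}\mathbf{Txt}\beta\delta$-learns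 $L$ iff $\delta(\beta(h,T),T)$ holds for every text $T$ for $L$; $[\mathcal{C}\mathbf{Txt}\beta\delta]_{\mathbf{REC}}$ is the set of all classes $\mathcal{L}\subseteq\mathbf{REC}$ for which some $h\in\mathcal{C}$ learns every $L\in\mathcal{L}$. -}

module Defs where

open import Level using (0ℓ) renaming (suc to lsuc)
open import Data.Nat using (ℕ; zero; suc; _+_; _<_; _≤_; _<?_)
open import Data.Fin using (Fin; fromℕ<)
open import Data.Vec using (Vec; []; _∷_)
open import Data.Maybe using (Maybe; just; nothing)
open import Data.Product using (Σ; ∃; _×_; _,_)
open import Relation.Nullary using (¬_; yes; no)
open import Relation.Unary using (Pred)
open import Relation.Binary.PropositionalEquality using (_≡_)

data PR : ℕ → Set where
  Z    : ∀ {n} → PR n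
  S    : PR 1
  P    : ∀ {n} → Fin n → PR n
  Comp : ∀ {m n} → PR m → Vec (PR n) m → PR n
  Rec  : ∀ {n} → PR n → PR (suc (suc n)) → PR (suc n)
  Mu   : ∀ {n} → PR (suc n) → PR n

lookupV : ∀ {n} → Vec ℕ n → Fin n → ℕ
lookupV (x ∷ xs) Fin.zero    = x
lookupV (x ∷ xs) (Fin.suc i) = lookupV xs i

mutual
  data _[_]⇓_ : ∀ {n} → PR n → Vec ℕ n → ℕ → Set where
    evZ    : ∀ {n} {xs : Vec ℕ n} → Z [ xs ]⇓ 0
    evS    : ∀ {x} → S [ x ∷ [] ]⇓ suc x
    evP    : ∀ {n} {xs : Vec ℕ n} {i} → P i [ xs ]⇓ lookupV xs i
    evComp : ∀ {m n} {f : PR m} {gs : Vec (PR n) m} {xs ys y} →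
             gs [ xs ]⇓* ys → f [ ys ]⇓ y → Comp f gs [ xs ]⇓ y
    evRec0 : ∀ {n} {f : PR n} {g xs y} → f [ xs ]⇓ y → Rec f g [ 0 ∷ xs ]⇓ y
    evRecS : ∀ {n} {f : PR n} {g x xs z y} →
             Rec f g [ x ∷ xs ]⇓ z → g [ x ∷ z ∷ xs ]⇓ y →
             Rec f g [ suc x ∷ xs ]⇓ y
    evMu   : ∀ {n} {f : PR (suc n)} {xs y} →
             f [ y ∷ xs ]⇓ 0 →
             (∀ z → z < y → Σ ℕ (λ k → f [ z ∷ xs ]⇓ suc k)) →
             Mu f [ xs ]⇓ y

  data _[_]⇓*_ : ∀ {m n} → Vec (PR n) m → Vec ℕ n → Vec ℕ m → Set where
    ev[] : ∀ {n} {xs : Vec ℕ n} → [] [ xs ]⇓* []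
    ev∷  : ∀ {m n} {g : PR n} {gs : Vec (PR n) m} {xs y ys} →
           g [ xs ]⇓ y → gs [ xs ]⇓* ys → (g ∷ gs) [ xs ]⇓* (y ∷ ys)

tri : ℕ → ℕ
tri zero    = 0
tri (suc n) = suc n + tri n

pair : ℕ → ℕ → ℕ
pair a b = tri (a + b) + a

unpair : ℕ → ℕ × ℕ
unpair zero = (0 , 0)
unpair (suc k) with unpair k
... | (a , zero)  = (0 , suc a)
... | (a , suc b) = (suc a , b)

-- Gödel numbering of μ-recursive terms (fuel bounds the recursion depth;
-- with fuel k+1 decoding code k never runs out, since all sub-codes of a
-- non-leaf code are strictly smaller).

mutual
  decodeF : ℕ → (n : ℕ) → ℕ → PR n
  decodeF zero n k = Z
  decodeF (suc fu) n k with unpair k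
  ... | (0 , r) = Z
  ... | (1 , r) = decS n
  ... | (2 , r) = decP n r
  ... | (3 , r) with unpair r
  ...   | (m , r') with unpair r'
  ...     | (cf , cgs) = Comp (decodeF fu m cf) (decodeVecF fu n m cgs)
  decodeF (suc fu) zero k    | (4 , r) = Z
  decodeF (suc fu) (suc n) k | (4 , r) with unpair r
  ... | (cf , cg) = Rec (decodeF fu n cf) (decodeF fu (suc (suc n)) cg)
  decodeF (suc fu) n k | (suc (suc (suc (suc (suc _)))) , r) =
    Mu (decodeF fu (suc n) r)

  decodeVecF : ℕ → (n m : ℕ) → ℕ → Vec (PR n) m
  decodeVecF fu n zero r = []
  decodeVecF fu n (suc m) r with unpair r
  ... | (a , b) = decodeF fu n a ∷ decodeVecF fu n m b

  decS : (n : ℕ) → PR n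
  decS (suc zero) = S
  decS n = Z

  decP : (n : ℕ) → ℕ → PR n
  decP n r with r <? n
  ... | yes r<n = P (fromℕ< r<n)
  ... | no _    = Z

decode : (n : ℕ) → ℕ → PR n
decode n k = decodeF (suc k) n k

φ : ℕ → ℕ → ℕ → Set
φ e x y = decode 1 e [ x ∷ [] ]⇓ y

Numbering : Set₁
Numbering = ℕ → ℕ → ℕ → Set      -- ψ e x y  :  ψ_e(x) ↓ = y

ComputableTotal : (ℕ → ℕ) → Set
ComputableTotal t = ∃ λ i → ∀ e → φ i e (t e)

record Acceptable (ψ : Numbering) : Set where
  field
    to       : ℕ → ℕ
    to-comp  : ComputableTotal to
    to-spec  : ∀ e x y → (ψ e x y → φ (to e) x y) × (φ (to e) x y → ψ e x y)
    from     : ℕ → ℕ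
    from-comp : ComputableTotal from
    from-spec : ∀ e x y → (φ e x y → ψ (from e) x y) × (ψ (from e) x y → φ e x y)

module Learning (ψ : Numbering) where

  CIndex : ℕ → Set
  CIndex e = ∀ x → ∃ λ y → ψ e x y × y ≤ 1

  C : ℕ → ℕ → Set
  C e x = ψ e x 1

  REC : Pred ℕ 0ℓ → Set
  REC L = ∃ λ e → CIndex e × (∀ x → (L x → C e x) × (C e x → L x))

  -- Texts: nothing plays the role of the pause symbol #.
  Text : Set
  Text = ℕ → Maybe ℕ

  content : Text → ℕ → Set
  content T x = ∃ λ i → T i ≡ just x

  TextFor : Text → Pred ℕ 0ℓ → Set
  TextFor T L = ∀ x → (L x → content T x) × (content T x → L x)

  -- coding of learner inputs: h(ε) = ψ_h(0), h(p,x) = ψ_h(1 + ⟨p, code x⟩)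
  codeIn : Maybe ℕ → ℕ
  codeIn nothing  = 0
  codeIn (just n) = suc n

  data It (h : ℕ) (T : Text) : ℕ → ℕ → Set where
    it0 : ∀ {p} → ψ h 0 p → It h T 0 p
    itS : ∀ {i p q} → It h T i p → ψ h (suc (pair p (codeIn (T i)))) q →
          It h T (suc i) q

  ItCIndExC : ℕ → Text → Set
  ItCIndExC h T =
    (∀ i → ∃ λ p → It h T i p × CIndex p) ×
    (∃ λ n₀ → ∃ λ e → (∀ n → n₀ ≤ n → It h T n e) × CIndex e ×
        (∀ x → (content T x → C e x) × (C e x → content T x)))

  Learns : ℕ → Pred ℕ 0ℓ → Set
  Learns h L = ∀ T → TextFor T L → ItCIndExC h T

  Total : ℕ → Set
  Total h = ∀ x → ∃ λ y → ψ h x y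

  Class : Set₁
  Class = Pred ℕ 0ℓ → Set

  _⊆REC : Class → Set₁
  𝓛 ⊆REC = ∀ L → 𝓛 L → REC L

  InTxtItCIndExC : Class → Set₁
  InTxtItCIndExC 𝓛 = 𝓛 ⊆REC × ∃ λ h → ∀ L → 𝓛 L → Learns h L

  InRTxtItCIndExC : Class → Set₁
  InRTxtItCIndExC 𝓛 = 𝓛 ⊆REC × ∃ λ h → Total h × (∀ L → 𝓛 L → Learns h L)

{-# OPTIONS --safe #-}
module Submission where

-- Run a total learner f along ⟪ e , 0 ⟫, ⟪ e , 1 ⟫, …, where e is a program for f, and select
-- those ⟪ e , x ⟫ that change the hypothesis (and ⟪ e , 0 ⟫), replacing the others by pauses.
-- If f learns the set L of selected elements, it converges, so some late ⟪ e , z ⟫ is not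
-- selected and f cannot tell L from L ∪ {⟪ e , z ⟫}. A partial iterative learner that assumes the
-- first component of each datum to be a program of a total f can decide selection, and therefore
-- learns all these L and L ∪ {⟪ e , z ⟫}: it moves from ∅ to L on a selected element, and to
-- L ∪ {⟪ e , z ⟫} on an unselected ⟪ e , z ⟫, which is unique. Deciding selection for all e
-- requires a universal program, here a stack machine.

open import Defs
open import Data.Empty using (⊥)
open import Data.Fin using (Fin; zero; suc; toℕ; #_)
open import Data.Fin.Properties using (fromℕ<-toℕ; toℕ<n)
open import Data.Maybe using (Maybe; just; nothing)
open import Data.Nat
open import Data.Nat.Properties
open import Data.Product using (Σ; ∃; _×_; _,_; proj₁; proj₂)
open import Data.Sum using (_⊎_; inj₁; inj₂)
open import Data.Vec using (Vec; []; _∷_)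
open import Relation.Nullary using (¬_; yes; no; contradiction)
open import Relation.Unary using (Pred)
open import Relation.Binary.Definitions using (tri<; tri≈; tri>)
open import Relation.Binary.PropositionalEquality

variable
  m n : ℕ

-- Zero test and inequality test on the naturals

ifz : {A : Set} → ℕ → A → A → A
ifz zero    a b = a
ifz (suc _) a b = b

differ : ℕ → ℕ → ℕ
differ zero    zero    = 0
differ zero    (suc _) = 1
differ (suc _) zero    = 1
differ (suc a) (suc b) = differ a b

differ-refl : ∀ a → differ a a ≡ 0
differ-refl zero    = refl
differ-refl (suc a) = differ-refl a

differ≡0⇒≡ : ∀ a b → differ a b ≡ 0 → a ≡ b
differ≡0⇒≡ zero    zero    _  = refl
differ≡0⇒≡ (suc a) (suc b) eq = cong suc (differ≡0⇒≡ a b eq)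

≢⇒differ≡1 : ∀ a b → a ≢ b → differ a b ≡ 1
≢⇒differ≡1 zero    zero    a≢b = contradiction refl a≢b
≢⇒differ≡1 zero    (suc b) a≢b = refl
≢⇒differ≡1 (suc a) zero    a≢b = refl
≢⇒differ≡1 (suc a) (suc b) a≢b = ≢⇒differ≡1 a b (λ eq → a≢b (cong suc eq))

differ-bit : ∀ a b → differ a b ≡ 0 ⊎ differ a b ≡ 1
differ-bit zero    zero    = inj₁ refl
differ-bit zero    (suc b) = inj₂ refl
differ-bit (suc a) zero    = inj₂ refl
differ-bit (suc a) (suc b) = differ-bit a b

-- The sum of the two truncated differences vanishes only for equal arguments. This turns the double
-- recursion of `differ` into a term, see `differP`.
differ-via-∸ : ∀ a b → ifz ((a ∸ b) + (b ∸ a)) 0 1 ≡ differ a b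
differ-via-∸ zero    zero    = refl
differ-via-∸ zero    (suc b) = refl
differ-via-∸ (suc a) zero    = refl
differ-via-∸ (suc a) (suc b) = differ-via-∸ a b

-- Pairing

pair-0-suc : ∀ b → pair 0 (suc b) ≡ suc (pair b 0)
pair-0-suc b rewrite +-identityʳ b | +-identityʳ (b + tri b) = cong suc (+-comm b (tri b))

pair-suc : ∀ a b → pair (suc a) b ≡ suc (pair a (suc b))
pair-suc a b rewrite +-suc a b = +-suc (suc (a + b) + tri (a + b)) a

-- Induction along the Cantor enumeration: the successor of a code either moves along its diagonal
-- or jumps from the end `(b , 0)` of one diagonal to the start of the next. The recursion `go` is
-- lexicographic in the diagonal and `a`.
pair-elim : (Q : ℕ → ℕ → ℕ → Set) → Q 0 0 0 →
            (∀ b k → Q b 0 k → Q 0 (suc b) (suc k)) →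
            (∀ a b k → Q a (suc b) k → Q (suc a) b (suc k)) →
            ∀ a b → Q a b (pair a b)
pair-elim Q base row diag a b = go (a + b) a b refl
  where
  go : ∀ s a b → a + b ≡ s → Q a b (pair a b)
  go zero    zero    zero    eq = base
  go (suc s) zero    (suc b) eq = subst (Q 0 (suc b)) (sym (pair-0-suc b))
    (row b _ (go s b 0 (trans (+-identityʳ b) (suc-injective eq))))
  go s       (suc a) b       eq = subst (Q (suc a) b) (sym (pair-suc a b))
    (diag a b _ (go s a (suc b) (trans (+-suc a b) eq)))

unpair-pair : ∀ a b → unpair (pair a b) ≡ (a , b)
unpair-pair = pair-elim (λ a b k → unpair k ≡ (a , b)) refl row diag
  where
  row : ∀ b k → unpair k ≡ (b , 0) → unpair (suc k) ≡ (0 , suc b)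
  row b k eq rewrite eq = refl
  diag : ∀ a b k → unpair k ≡ (a , suc b) → unpair (suc k) ≡ (suc a , b)
  diag a b k eq rewrite eq = refl

pair-unpair : ∀ k → pair (proj₁ (unpair k)) (proj₂ (unpair k)) ≡ k
pair-unpair zero = refl
pair-unpair (suc k) with unpair k | pair-unpair k
... | a , zero  | eq = trans (pair-0-suc a) (cong suc eq)
... | a , suc b | eq = trans (pair-suc a b) (cong suc eq)

-- Opacity keeps the unary codes of concrete programs from being evaluated.
opaque
  ⟪_,_⟫ : ℕ → ℕ → ℕ
  ⟪ a , b ⟫ = pair a b

  π₁ π₂ : ℕ → ℕ
  π₁ k = proj₁ (unpair k)
  π₂ k = proj₂ (unpair k)

  ⟪⟫≡pair : ∀ a b → ⟪ a , b ⟫ ≡ pair a b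
  ⟪⟫≡pair a b = refl

  π₁-⟪⟫ : ∀ a b → π₁ ⟪ a , b ⟫ ≡ a
  π₁-⟪⟫ a b = cong proj₁ (unpair-pair a b)

  π₂-⟪⟫ : ∀ a b → π₂ ⟪ a , b ⟫ ≡ b
  π₂-⟪⟫ a b = cong proj₂ (unpair-pair a b)

  ⟪π₁,π₂⟫ : ∀ k → ⟪ π₁ k , π₂ k ⟫ ≡ k
  ⟪π₁,π₂⟫ = pair-unpair

  π₁-0 : π₁ 0 ≡ 0
  π₁-0 = refl

  π₂-0 : π₂ 0 ≡ 0
  π₂-0 = refl

-- The diagonal `a + b` on which the code lies, found by primitive recursion: it grows exactly after
-- `tri w + w`, the last code of diagonal `w`. Both projections are then truncated differences.
weight : ℕ → ℕ
weight zero    = 0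
weight (suc k) = ifz (differ k (tri (weight k) + weight k)) (suc (weight k)) (weight k)

opaque
  unfolding ⟪_,_⟫

  weight-pair : ∀ a b → weight (pair a b) ≡ a + b
  weight-pair a b = proj₂ (pair-elim Q (refl , refl) row diag a b)
    where
    Q : ℕ → ℕ → ℕ → Set
    Q a b k = k ≡ tri (a + b) + a × weight k ≡ a + b
    row : ∀ b k → Q b 0 k → Q 0 (suc b) (suc k)
    row b k (k≡ , w≡) rewrite w≡ | +-identityʳ b | sym k≡ | differ-refl k =
      trans (cong suc (trans k≡ (+-comm (tri b) b))) (sym (+-identityʳ _)) , refl
    diag : ∀ a b k → Q a (suc b) k → Q (suc a) b (suc k)
    -- The position `a` is below the weight `suc (a + b)`, so `k` is not the last code of its
    -- diagonal and the weight stays the same.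
    diag a b k (k≡ , w≡)
      rewrite w≡ | +-suc a b
            | ≢⇒differ≡1 k (tri (suc (a + b)) + suc (a + b))
                (λ e → m≢1+m+n a (+-cancelˡ-≡ (tri (suc (a + b))) _ _ (trans (sym k≡) e)))
      = trans (cong suc k≡) (sym (+-suc _ a)) , refl

  π₁-weight : ∀ k → k ∸ tri (weight k) ≡ π₁ k
  π₁-weight k with unpair k | pair-unpair k
  ... | a , b | refl rewrite weight-pair a b = m+n∸m≡n (tri (a + b)) a

  π₂-weight : ∀ k → weight k ∸ π₁ k ≡ π₂ k
  π₂-weight k with unpair k | pair-unpair k
  ... | a , b | refl rewrite weight-pair a b = m+n∸m≡n a b

-- Primitive recursive functions, each packaged with a term

record Prim (n : ℕ) : Set where
  field
    ⟦_⟧      : Vec ℕ n → ℕ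
    term     : PR n
    computes : ∀ xs → term [ xs ]⇓ ⟦_⟧ xs
open Prim

⟦_⟧* : Vec (Prim n) m → Vec ℕ n → Vec ℕ m
⟦ []     ⟧* xs = []
⟦ p ∷ ps ⟧* xs = ⟦ p ⟧ xs ∷ ⟦ ps ⟧* xs

terms : Vec (Prim n) m → Vec (PR n) m
terms []       = []
terms (p ∷ ps) = term p ∷ terms ps

computes* : (ps : Vec (Prim n) m) → ∀ xs → terms ps [ xs ]⇓* ⟦ ps ⟧* xs
computes* []       xs = ev[]
computes* (p ∷ ps) xs = ev∷ (computes p xs) (computes* ps xs)

prim₁ : (f : ℕ → ℕ) (t : PR 1) → (∀ x → t [ x ∷ [] ]⇓ f x) → Prim 1
prim₁ f t ev .⟦_⟧ (x ∷ [])     = f x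
prim₁ f t ev .term             = t
prim₁ f t ev .computes (x ∷ []) = ev x

prim₂ : (f : ℕ → ℕ → ℕ) (t : PR 2) → (∀ x y → t [ x ∷ y ∷ [] ]⇓ f x y) → Prim 2
prim₂ f t ev .⟦_⟧ (x ∷ y ∷ [])     = f x y
prim₂ f t ev .term                 = t
prim₂ f t ev .computes (x ∷ y ∷ []) = ev x y

var : Fin n → Prim n
var i = record { ⟦_⟧ = λ xs → lookupV xs i ; term = P i ; computes = λ xs → evP }

numeral : ℕ → PR n
numeral zero    = Z
numeral (suc k) = Comp S (numeral k ∷ [])

numeral-⇓ : ∀ k (xs : Vec ℕ n) → numeral k [ xs ]⇓ k
numeral-⇓ zero    xs = evZ
numeral-⇓ (suc k) xs = evComp (ev∷ (numeral-⇓ k xs) ev[]) evS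

num : ℕ → Prim n
num k = record { ⟦_⟧ = λ _ → k ; term = numeral k ; computes = numeral-⇓ k }

call : Prim m → Vec (Prim n) m → Prim n
call p ps = record
  { ⟦_⟧      = λ xs → ⟦ p ⟧ (⟦ ps ⟧* xs)
  ; term     = Comp (term p) (terms ps)
  ; computes = λ xs → evComp (computes* ps xs) (computes p (⟦ ps ⟧* xs))
  }

evaluates : (p : Prim n) → ∀ {xs y} → ⟦ p ⟧ xs ≡ y → term p [ xs ]⇓ y
evaluates p {xs} refl = computes p xs

sucP : Prim 1
sucP = prim₁ suc S (λ x → evS)

predP : Prim 1
predP = prim₁ pred (Rec Z (P (# 0))) ev
  where
  ev : ∀ x → Rec Z (P (# 0)) [ x ∷ [] ]⇓ pred x
  ev zero    = evRec0 evZ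
  ev (suc x) = evRecS (ev x) evP

ifzP : Prim 3
ifzP .⟦_⟧ (c ∷ a ∷ b ∷ []) = ifz c a b
ifzP .term = Rec (P (# 0)) (P (# 3))
ifzP .computes (zero ∷ a ∷ b ∷ []) = evRec0 evP
ifzP .computes (suc c ∷ a ∷ b ∷ []) = evRecS (computes ifzP (c ∷ a ∷ b ∷ [])) evP

ifP : Prim n → Prim n → Prim n → Prim n
ifP c a b = call ifzP (c ∷ a ∷ b ∷ [])

addP : Prim 2
addP = prim₂ _+_ t ev
  where
  t = Rec (P (# 0)) (Comp S (P (# 1) ∷ []))
  ev : ∀ x y → t [ x ∷ y ∷ [] ]⇓ (x + y)
  ev zero    y = evRec0 evP
  ev (suc x) y = evRecS (ev x y) (evComp (ev∷ evP ev[]) evS)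

-- `Rec` recurses on its first argument, whereas `x ∸ y` takes `y` predecessors of `x`; hence the
-- swap.
monusP : Prim 2
monusP = prim₂ _∸_ (Comp t (P (# 1) ∷ P (# 0) ∷ [])) (λ x y → evComp (ev∷ evP (ev∷ evP ev[])) (ev y x))
  where
  t = Rec (P (# 0)) (Comp (term predP) (P (# 1) ∷ []))
  ev : ∀ y x → t [ y ∷ x ∷ [] ]⇓ (x ∸ y)
  ev zero    x = evRec0 evP
  ev (suc y) x = subst (t [ suc y ∷ x ∷ [] ]⇓_) (pred[m∸n]≡m∸[1+n] x y)
    (evRecS (ev y x) (evComp (ev∷ evP ev[]) (computes predP (x ∸ y ∷ []))))

differP : Prim 2
differP = prim₂ differ (term p) λ x y → evaluates p (differ-via-∸ x y)
  where
  p : Prim 2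
  p = ifP (call addP (call monusP (var (# 0) ∷ var (# 1) ∷ []) ∷ call monusP (var (# 1) ∷ var (# 0) ∷ []) ∷ []))
          (num 0) (num 1)

triP : Prim 1
triP = prim₁ tri t ev
  where
  s : Prim 2
  s = call addP (call sucP (var (# 0) ∷ []) ∷ var (# 1) ∷ [])
  t = Rec Z (term s)
  ev : ∀ x → t [ x ∷ [] ]⇓ tri x
  ev zero    = evRec0 evZ
  ev (suc x) = evRecS (ev x) (computes s (x ∷ tri x ∷ []))

weightP : Prim 1
weightP = prim₁ weight t ev
  where
  s : Prim 2
  s = ifP (call differP (var (# 0) ∷ call addP (call triP (var (# 1) ∷ []) ∷ var (# 1) ∷ []) ∷ []))
          (call sucP (var (# 1) ∷ [])) (var (# 1))
  t = Rec Z (term s)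
  ev : ∀ x → t [ x ∷ [] ]⇓ weight x
  ev zero    = evRec0 evZ
  ev (suc x) = evRecS (ev x) (computes s (x ∷ weight x ∷ []))

π₁P : Prim 1
π₁P = prim₁ π₁ (term p) λ x → evaluates p (π₁-weight x)
  where
  p : Prim 1
  p = call monusP (var (# 0) ∷ call triP (call weightP (var (# 0) ∷ []) ∷ []) ∷ [])

π₂P : Prim 1
π₂P = prim₁ π₂ (term p) λ x → evaluates p (π₂-weight x)
  where
  p : Prim 1
  p = call monusP (call weightP (var (# 0) ∷ []) ∷ call π₁P (var (# 0) ∷ []) ∷ [])

pairP : Prim 2
pairP = prim₂ ⟪_,_⟫ (term p) λ x y → evaluates p (sym (⟪⟫≡pair x y))
  where
  p : Prim 2
  p = call addP (call triP (call addP (var (# 0) ∷ var (# 1) ∷ []) ∷ []) ∷ var (# 0) ∷ [])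

infixr 5 _,ᵖ_
_,ᵖ_ : Prim n → Prim n → Prim n
a ,ᵖ b = call pairP (a ∷ b ∷ [])

fstᵖ sndᵖ sucᵖ : Prim n → Prim n
fstᵖ a = call π₁P (a ∷ [])
sndᵖ a = call π₂P (a ∷ [])
sucᵖ a = call sucP (a ∷ [])

switch : Prim n → Vec (Prim n) m → Prim n → Prim n
switch c []       d = d
switch c (b ∷ bs) d = ifP c b (switch (call predP (c ∷ [])) bs d)

-- A universal stack machine

-- A configuration ⟪ K , ⟪ v , s ⟫ ⟫ is a stack K of instructions and a stack of values with
-- top v; an instruction is ⟪ opcode , argument ⟫. Since π₁ 0 = 0, the empty instruction
-- stack 0 presents the opcode 0, which halts.

dispatch : Prim 6
dispatch = switch (var (# 0))
  ( var (# 5)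
  ∷ (K ,ᵖ num 0 ,ᵖ s)
  ∷ (K ,ᵖ sucᵖ v ,ᵖ s)
  ∷ (K ,ᵖ call predP (v ∷ []) ,ᵖ s)
  ∷ (K ,ᵖ fstᵖ v ,ᵖ s)
  ∷ (K ,ᵖ sndᵖ v ,ᵖ s)
  ∷ (K ,ᵖ v ,ᵖ v ,ᵖ s)
  ∷ (K ,ᵖ fstᵖ s ,ᵖ v ,ᵖ sndᵖ s)
  ∷ (K ,ᵖ (fstᵖ s ,ᵖ v) ,ᵖ sndᵖ s)
  ∷ ((fstᵖ arg ,ᵖ sndᵖ arg ,ᵖ K) ,ᵖ v ,ᵖ s)
  ∷ [])
  -- The default, reached by opcode 10, is a while loop: on a nonzero first component the body is
  -- pushed, followed by the loop itself.
  (ifP (fstᵖ v) (K ,ᵖ sndᵖ v ,ᵖ s) ((arg ,ᵖ (num 10 ,ᵖ arg) ,ᵖ K) ,ᵖ v ,ᵖ s))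
  where
  arg K v s : Prim 6
  arg = var (# 1)
  K   = var (# 2)
  v   = var (# 3)
  s   = var (# 4)

stepP : Prim 1
stepP = call dispatch
  ( fstᵖ (fstᵖ (fstᵖ c)) ∷ sndᵖ (fstᵖ (fstᵖ c)) ∷ sndᵖ (fstᵖ c)
  ∷ fstᵖ (sndᵖ c) ∷ sndᵖ (sndᵖ c) ∷ c ∷ [])
  where
  c : Prim 1
  c = var (# 0)

step : ℕ → ℕ
step c = ⟦ stepP ⟧ (c ∷ [])

opcode : ℕ → ℕ
opcode c = π₁ (π₁ (π₁ c))

run : ℕ → ℕ → ℕ
run zero    c = c
run (suc n) c = step (run n c)

runP : Prim 2
runP = prim₂ run t ev
  where
  s : Prim 3
  s = call stepP (var (# 1) ∷ [])
  t = Rec (P (# 0)) (term s)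
  ev : ∀ n c → t [ n ∷ c ∷ [] ]⇓ run n c
  ev zero    c = evRec0 evP
  ev (suc n) c = evRecS (ev n c) (computes s (n ∷ run n c ∷ c ∷ []))

run-+ : ∀ m n c → run (m + n) c ≡ run m (run n c)
run-+ zero    n c = refl
run-+ (suc m) n c = cong step (run-+ m n c)

step-halted : ∀ c → opcode c ≡ 0 → step c ≡ c
step-halted c eq rewrite eq = refl

run-halted : ∀ n c → opcode c ≡ 0 → run n c ≡ c
run-halted zero    c eq = refl
run-halted (suc n) c eq = trans (cong step (run-halted n c eq)) (step-halted c eq)

infix 4 _⟶*_
_⟶*_ : ℕ → ℕ → Set
c ⟶* d = ∃ λ n → run n c ≡ d

step⟶ : ∀ {c d} → step c ≡ d → c ⟶* d
step⟶ eq = 1 , eq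

infixr 5 _⨾_
_⨾_ : ∀ {a b c} → a ⟶* b → b ⟶* c → a ⟶* c
_⨾_ {a} (m , p) (n , q) = n + m , trans (run-+ n m a) (trans (cong (run n) p) q)

config : ℕ → ℕ → ℕ → ℕ → ℕ
config i K v s = ⟪ ⟪ i , K ⟫ , ⟪ v , s ⟫ ⟫

-- Does the unpairing that opacity blocks, once for all instructions; a concrete opcode then selects
-- its branch by computation.
step-dispatch : ∀ o a K v s → step (config ⟪ o , a ⟫ K v s) ≡
  ⟦ dispatch ⟧ (o ∷ a ∷ K ∷ v ∷ s ∷ config ⟪ o , a ⟫ K v s ∷ [])
step-dispatch o a K v s
  rewrite π₁-⟪⟫ ⟪ ⟪ o , a ⟫ , K ⟫ ⟪ v , s ⟫ | π₂-⟪⟫ ⟪ ⟪ o , a ⟫ , K ⟫ ⟪ v , s ⟫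
        | π₁-⟪⟫ ⟪ o , a ⟫ K | π₂-⟪⟫ ⟪ o , a ⟫ K | π₁-⟪⟫ o a | π₂-⟪⟫ o a
        | π₁-⟪⟫ v s | π₂-⟪⟫ v s = refl

opZero opSuc opPred opFst opSnd opDup opSwap opPair : ℕ
opZero = ⟪ 1 , 0 ⟫
opSuc  = ⟪ 2 , 0 ⟫
opPred = ⟪ 3 , 0 ⟫
opFst  = ⟪ 4 , 0 ⟫
opSnd  = ⟪ 5 , 0 ⟫
opDup  = ⟪ 6 , 0 ⟫
opSwap = ⟪ 7 , 0 ⟫
opPair = ⟪ 8 , 0 ⟫

infixr 6 _▸_
_▸_ : ℕ → ℕ → ℕ
a ▸ b = ⟪ 9 , ⟪ a , b ⟫ ⟫

opLoop : ℕ → ℕ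
opLoop c = ⟪ 10 , c ⟫

infix 4 _∶_↦_
-- Quantifying over the rest of both stacks makes these judgements compose: the net effect is
-- confined to the top value.
_∶_↦_ : ℕ → ℕ → ℕ → Set
i ∶ x ↦ y = ∀ K s → config i K x s ⟶* ⟪ K , ⟪ y , s ⟫ ⟫

zero↦ : ∀ {x} → opZero ∶ x ↦ 0
zero↦ K s = step⟶ (step-dispatch 1 0 K _ s)

suc↦ : ∀ {x} → opSuc ∶ x ↦ suc x
suc↦ K s = step⟶ (step-dispatch 2 0 K _ s)

pred↦ : ∀ {x} → opPred ∶ x ↦ pred x
pred↦ K s = step⟶ (step-dispatch 3 0 K _ s)

fst↦ : ∀ {x y} → opFst ∶ ⟪ x , y ⟫ ↦ x
fst↦ {x} {y} K s = step⟶ (trans (step-dispatch 4 0 K _ s) (cong (λ z → ⟪ K , ⟪ z , s ⟫ ⟫) (π₁-⟪⟫ x y)))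

snd↦ : ∀ {x y} → opSnd ∶ ⟪ x , y ⟫ ↦ y
snd↦ {x} {y} K s = step⟶ (trans (step-dispatch 5 0 K _ s) (cong (λ z → ⟪ K , ⟪ z , s ⟫ ⟫) (π₂-⟪⟫ x y)))

dup-⟶ : ∀ K v s → config opDup K v s ⟶* ⟪ K , ⟪ v , ⟪ v , s ⟫ ⟫ ⟫
dup-⟶ K v s = step⟶ (step-dispatch 6 0 K v s)

swap-⟶ : ∀ K v w s → config opSwap K v ⟪ w , s ⟫ ⟶* ⟪ K , ⟪ w , ⟪ v , s ⟫ ⟫ ⟫
swap-⟶ K v w s = step⟶ (trans (step-dispatch 7 0 K v ⟪ w , s ⟫)
  (cong₂ (λ a b → ⟪ K , ⟪ a , ⟪ v , b ⟫ ⟫ ⟫) (π₁-⟪⟫ w s) (π₂-⟪⟫ w s)))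

pair-⟶ : ∀ K v w s → config opPair K v ⟪ w , s ⟫ ⟶* ⟪ K , ⟪ ⟪ w , v ⟫ , s ⟫ ⟫
pair-⟶ K v w s = step⟶ (trans (step-dispatch 8 0 K v ⟪ w , s ⟫)
  (cong₂ (λ a b → ⟪ K , ⟪ ⟪ a , v ⟫ , b ⟫ ⟫) (π₁-⟪⟫ w s) (π₂-⟪⟫ w s)))

seq-⟶ : ∀ a b K v s → config (a ▸ b) K v s ⟶* config a ⟪ b , K ⟫ v s
seq-⟶ a b K v s = step⟶ (trans (step-dispatch 9 ⟪ a , b ⟫ K v s)
  (cong₂ (λ a b → ⟪ ⟪ a , ⟪ b , K ⟫ ⟫ , ⟪ v , s ⟫ ⟫) (π₁-⟪⟫ a b) (π₂-⟪⟫ a b)))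

loop-exit : ∀ c K v s → config (opLoop c) K ⟪ 0 , v ⟫ s ⟶* ⟪ K , ⟪ v , s ⟫ ⟫
loop-exit c K v s = step⟶ (trans (step-dispatch 10 c K ⟪ 0 , v ⟫ s) exit)
  where
  exit : ⟦ dispatch ⟧ (10 ∷ c ∷ K ∷ ⟪ 0 , v ⟫ ∷ s ∷ config (opLoop c) K ⟪ 0 , v ⟫ s ∷ []) ≡ ⟪ K , ⟪ v , s ⟫ ⟫
  exit rewrite π₁-⟪⟫ 0 v | π₂-⟪⟫ 0 v = refl

loop-again : ∀ c K k v s → config (opLoop c) K ⟪ suc k , v ⟫ s ⟶* config c ⟪ opLoop c , K ⟫ ⟪ suc k , v ⟫ s
loop-again c K k v s = step⟶ (trans (step-dispatch 10 c K ⟪ suc k , v ⟫ s) again)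
  where
  again : ⟦ dispatch ⟧ (10 ∷ c ∷ K ∷ ⟪ suc k , v ⟫ ∷ s ∷ config (opLoop c) K ⟪ suc k , v ⟫ s ∷ [])
        ≡ config c ⟪ opLoop c , K ⟫ ⟪ suc k , v ⟫ s
  again rewrite π₁-⟪⟫ (suc k) v = refl

infixr 6 _▸↦_
_▸↦_ : ∀ {a b x y z} → a ∶ x ↦ y → b ∶ y ↦ z → a ▸ b ∶ x ↦ z
(p ▸↦ q) K s = seq-⟶ _ _ K _ s ⨾ p ⟪ _ , K ⟫ s ⨾ q K s

opId : ℕ
opId = opSuc ▸ opPred

id↦ : ∀ {x} → opId ∶ x ↦ x
id↦ = suc↦ ▸↦ pred↦

-- The code `a` consumes a copy of the argument; the swap then brings the original to the top for
-- `b`.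
fork : ℕ → ℕ → ℕ
fork a b = opDup ▸ a ▸ opSwap ▸ b ▸ opPair

fork↦ : ∀ {a b x y z} → a ∶ x ↦ y → b ∶ x ↦ z → fork a b ∶ x ↦ ⟪ y , z ⟫
fork↦ {x = x} {y} {z} p q K s =
    seq-⟶ _ _ K x s ⨾ dup-⟶ _ x s
  ⨾ seq-⟶ _ _ K x _ ⨾ p _ ⟪ x , s ⟫
  ⨾ seq-⟶ _ _ K y _ ⨾ swap-⟶ _ y x s
  ⨾ seq-⟶ _ _ K x _ ⨾ q _ ⟪ y , s ⟫
  ⨾ pair-⟶ K z y s

-- Compilation to the universal machine

-- The loop state for primitive recursion is ⟪ remaining , ⟪ index , ⟪ value , xs ⟫ ⟫ ⟫, that for
-- minimisation is ⟪ f y xs , ⟪ y , xs ⟫ ⟫: a loop stops when the first component is 0.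

recBody : ℕ → ℕ
recBody g = fork (opFst ▸ opPred) (opSnd ▸ fork (opFst ▸ opSuc) (fork g (opSnd ▸ opSnd)))

recInit : ℕ → ℕ
recInit f = fork opFst (opSnd ▸ fork opZero (fork f opId))

muTest muBody : ℕ → ℕ
muTest f = fork f opId
muBody f = opSnd ▸ fork (opFst ▸ opSuc) opSnd ▸ muTest f

argument : ∀ {n} → Fin n → ℕ
argument zero    = opFst
argument (suc i) = opSnd ▸ argument i

compile  : ∀ {n} → PR n → ℕ
compile* : ∀ {m n} → Vec (PR n) m → ℕ
compile Z           = opZero
compile S           = opFst ▸ opSuc
compile (P i)       = argument i
compile (Comp f gs) = compile* gs ▸ compile f
compile (Rec f g)   = (recInit (compile f) ▸ opLoop (recBody (compile g))) ▸ opSnd ▸ opFst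
compile (Mu f)      = fork opZero opId ▸ (muTest (compile f) ▸ opLoop (muBody (compile f))) ▸ opFst
compile* []         = opZero
compile* (g ∷ gs)   = fork (compile g) (compile* gs)

tuple : ∀ {n} → Vec ℕ n → ℕ
tuple []       = 0
tuple (x ∷ xs) = ⟪ x , tuple xs ⟫

argument↦ : ∀ {n} (xs : Vec ℕ n) i → argument i ∶ tuple xs ↦ lookupV xs i
argument↦ (x ∷ xs) zero    = fst↦
argument↦ (x ∷ xs) (suc i) = snd↦ ▸↦ argument↦ xs i

compile↦  : ∀ {n} {t : PR n} {xs y} → t [ xs ]⇓ y → compile t ∶ tuple xs ↦ y
compile*↦ : ∀ {m n} {gs : Vec (PR n) m} {xs ys} → gs [ xs ]⇓* ys → compile* gs ∶ tuple xs ↦ tuple ys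
-- Loop invariant, with `x` rounds done and `r` still to do. Leaving `r` free carries the induction
-- on the derivation: the case `suc x` uses the case `x` with one more round to do.
recLoop-⟶ : ∀ {n} {f : PR n} {g x xs z} → Rec f g [ x ∷ xs ]⇓ z → ∀ r K s →
            config (recInit (compile f)) ⟪ opLoop (recBody (compile g)) , K ⟫ ⟪ x + r , tuple xs ⟫ s ⟶*
            config (opLoop (recBody (compile g))) K ⟪ r , ⟪ x , ⟪ z , tuple xs ⟫ ⟫ ⟫ s
-- Induction on the distance `d` from the current candidate `z` to the result `y`; every candidate
-- before `y` has a positive test value and sends the loop round again.
muLoop-⟶ : ∀ {n} {f : PR (suc n)} {xs y} → f [ y ∷ xs ]⇓ 0 →
            (∀ z → z < y → Σ ℕ (λ k → f [ z ∷ xs ]⇓ suc k)) → ∀ d z → z + d ≡ y → ∀ K s →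
            config (muTest (compile f)) ⟪ opLoop (muBody (compile f)) , K ⟫ ⟪ z , tuple xs ⟫ s ⟶*
            ⟪ K , ⟪ ⟪ y , tuple xs ⟫ , s ⟫ ⟫

compile↦ evZ = zero↦
compile↦ evS = fst↦ ▸↦ suc↦
compile↦ (evP {xs = xs} {i}) = argument↦ xs i
compile↦ (evComp ds d) = compile*↦ ds ▸↦ compile↦ d
compile↦ {t = Rec f g} {x ∷ xs} {y} d = recur ▸↦ snd↦ ▸↦ fst↦
  where
  recur : recInit (compile f) ▸ opLoop (recBody (compile g)) ∶ ⟪ x , tuple xs ⟫ ↦ ⟪ x , ⟪ y , tuple xs ⟫ ⟫
  recur K s =
      seq-⟶ _ _ K _ s
    ⨾ subst (λ k → config (recInit (compile f)) ⟪ opLoop (recBody (compile g)) , K ⟫ ⟪ k , tuple xs ⟫ s ⟶*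
                   config (opLoop (recBody (compile g))) K ⟪ 0 , ⟪ x , ⟪ y , tuple xs ⟫ ⟫ ⟫ s)
            (+-identityʳ x) (recLoop-⟶ d 0 K s)
    ⨾ loop-exit _ K _ s
compile↦ {t = Mu f} {xs} {y} (evMu d ds) = fork↦ zero↦ id↦ ▸↦ search ▸↦ fst↦
  where
  search : muTest (compile f) ▸ opLoop (muBody (compile f)) ∶ ⟪ 0 , tuple xs ⟫ ↦ ⟪ y , tuple xs ⟫
  search K s = seq-⟶ _ _ K _ s ⨾ muLoop-⟶ d ds y 0 refl K s

compile*↦ ev[]      = zero↦
compile*↦ (ev∷ d ds) = fork↦ (compile↦ d) (compile*↦ ds)
recLoop-⟶ (evRec0 d) r K s =
  fork↦ fst↦ (snd↦ ▸↦ fork↦ zero↦ (fork↦ (compile↦ d) id↦)) _ s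
recLoop-⟶ {f = f} {g} {suc x} {xs} {y} (evRecS {z = z} d e) r K s =
    subst (λ k → config (recInit (compile f)) ⟪ opLoop (recBody (compile g)) , K ⟫ ⟪ k , tuple xs ⟫ s ⟶*
                 config (opLoop (recBody (compile g))) K ⟪ suc r , ⟪ x , ⟪ z , tuple xs ⟫ ⟫ ⟫ s)
          (+-suc x r) (recLoop-⟶ d (suc r) K s)
  ⨾ loop-again _ K r _ s
  ⨾ fork↦ (fst↦ ▸↦ pred↦) (snd↦ ▸↦ fork↦ (fst↦ ▸↦ suc↦) (fork↦ (compile↦ e) (snd↦ ▸↦ snd↦))) _ s

muLoop-⟶ {y = y} d ds zero z z+0≡y K s rewrite +-identityʳ z | z+0≡y =
  fork↦ (compile↦ d) id↦ _ s ⨾ loop-exit _ K _ s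
muLoop-⟶ {y = y} d ds (suc r) z eq K s =
    fork↦ (compile↦ (proj₂ (ds z z<y))) id↦ _ s
  ⨾ loop-again _ K _ _ s
  ⨾ seq-⟶ _ _ _ _ s ⨾ snd↦ _ s
  ⨾ seq-⟶ _ _ _ _ s ⨾ fork↦ (fst↦ ▸↦ suc↦) snd↦ _ s
  ⨾ muLoop-⟶ d ds r (suc z) (trans (sym (+-suc z r)) eq) K s
  where
  z<y : z < y
  z<y = subst (z <_) eq (m<m+n z (s≤s z≤n))

-- Determinism of evaluation

⇓-deterministic  : ∀ {n} {t : PR n} {xs y z} → t [ xs ]⇓ y → t [ xs ]⇓ z → y ≡ z
⇓*-deterministic : ∀ {m n} {ts : Vec (PR n) m} {xs ys zs} → ts [ xs ]⇓* ys → ts [ xs ]⇓* zs → ys ≡ zs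
⇓-deterministic evZ evZ = refl
⇓-deterministic evS evS = refl
⇓-deterministic evP evP = refl
⇓-deterministic (evComp ds d) (evComp es e) with refl ← ⇓*-deterministic ds es = ⇓-deterministic d e
⇓-deterministic (evRec0 d) (evRec0 e) = ⇓-deterministic d e
⇓-deterministic (evRecS d d′) (evRecS e e′) with refl ← ⇓-deterministic d e = ⇓-deterministic d′ e′
-- At the smaller of two distinct results the function would be both zero and positive.
⇓-deterministic (evMu {y = y} d ds) (evMu {y = z} e es) with <-cmp y z
... | tri≈ _ y≡z _ = y≡z
... | tri< y<z _ _ = contradiction (⇓-deterministic d (proj₂ (es y y<z))) 0≢1+n
... | tri> _ _ z<y = contradiction (⇓-deterministic e (proj₂ (ds z z<y))) 0≢1+n
⇓*-deterministic ev[] ev[] = refl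
⇓*-deterministic (ev∷ d ds) (ev∷ e es) = cong₂ _∷_ (⇓-deterministic d e) (⇓*-deterministic ds es)

-- Halting times and the universal program

least-zero : ∀ (g : ℕ → ℕ) N → g N ≡ 0 →
  ∃ λ n → g n ≡ 0 × n ≤ N × (∀ z → z < n → ∃ λ k → g z ≡ suc k)
least-zero g N gN≡0 with g 0 in g0
least-zero g N       gN≡0 | zero = 0 , g0 , z≤n , λ _ ()
least-zero g zero    gN≡0 | suc k = contradiction (trans (sym gN≡0) g0) 0≢1+n
least-zero g (suc N) gN≡0 | suc k with least-zero (λ z → g (suc z)) N gN≡0
... | n , gn≡0 , n≤N , pos = suc n , gn≡0 , s≤s n≤N , λ
  { zero    _         → k , g0
  ; (suc z) (s≤s z<n) → pos z z<n }

-- Minimisation finds the first halting time, which may be earlier than the time at which `d` is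
-- known to be reached; a halted configuration is a fixed point of `step`, so it is `d` already.
halting-time : ∀ {c d} → c ⟶* d → opcode d ≡ 0 →
  ∃ λ τ → run τ c ≡ d × (∀ z → z < τ → ∃ λ k → opcode (run z c) ≡ suc k)
halting-time {c} {d} (N , run-N) halted
  with τ , halted-τ , τ≤N , running ← least-zero (λ k → opcode (run k c)) N (trans (cong opcode run-N) halted) =
  τ , run-τ , running
  where
  open ≡-Reasoning
  run-τ : run τ c ≡ d
  run-τ = begin
    run τ c                 ≡⟨ run-halted (N ∸ τ) _ halted-τ ⟨
    run (N ∸ τ) (run τ c)   ≡⟨ run-+ (N ∸ τ) τ c ⟨
    run (N ∸ τ + τ) c       ≡⟨ cong (λ k → run k c) (m∸n+n≡m τ≤N) ⟩
    run N c                 ≡⟨ run-N ⟩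
    d                       ∎

opcode-empty : ∀ s → opcode ⟪ 0 , s ⟫ ≡ 0
opcode-empty s rewrite π₁-⟪⟫ 0 s | π₁-0 = π₁-0

atTime haltTest readOff : Prim 3
atTime   = call runP (var (# 0) ∷ ((var (# 1) ,ᵖ num 0) ,ᵖ (var (# 2) ,ᵖ num 0) ,ᵖ num 0) ∷ [])
haltTest = fstᵖ (fstᵖ (fstᵖ atTime))
readOff  = fstᵖ (sndᵖ atTime)

opaque
  -- Kleene normal form: one minimisation finds the halting time, and a total function reads off the
  -- result.
  universal : PR 2
  universal = Comp (term readOff) (Mu (term haltTest) ∷ P (# 0) ∷ P (# 1) ∷ [])

  universal-complete : ∀ (t : PR 1) {x y} → t [ x ∷ [] ]⇓ y → universal [ compile t ∷ x ∷ [] ]⇓ y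
  universal-complete t {x} {y} d
    with τ , run-τ , running ← halting-time (compile↦ d 0 0) (opcode-empty ⟪ y , 0 ⟫) =
    evComp (ev∷ (evMu (test τ halted) (λ z z<τ → proj₁ (running z z<τ) , test z (proj₂ (running z z<τ))))
                (ev∷ evP (ev∷ evP ev[])))
           (evaluates readOff output)
    where
    start : ℕ
    start = config (compile t) 0 (tuple (x ∷ [])) 0
    test : ∀ z {k} → opcode (run z start) ≡ k → term haltTest [ z ∷ compile t ∷ x ∷ [] ]⇓ k
    test z = evaluates haltTest
    halted : opcode (run τ start) ≡ 0
    halted = trans (cong opcode run-τ) (opcode-empty ⟪ y , 0 ⟫)
    output : π₁ (π₂ (run τ start)) ≡ y
    output = trans (cong (λ c → π₁ (π₂ c)) run-τ) (trans (cong π₁ (π₂-⟪⟫ 0 ⟪ y , 0 ⟫)) (π₁-⟪⟫ y 0))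

-- Gödel numbers

encode  : ∀ {n} → PR n → ℕ
encode* : ∀ {m n} → Vec (PR n) m → ℕ
encode Z                  = ⟪ 0 , 0 ⟫
encode S                  = ⟪ 1 , 0 ⟫
encode (P i)              = ⟪ 2 , toℕ i ⟫
encode (Comp {m = m} f gs) = ⟪ 3 , ⟪ m , ⟪ encode f , encode* gs ⟫ ⟫ ⟫
encode (Rec f g)          = ⟪ 4 , ⟪ encode f , encode g ⟫ ⟫
encode (Mu f)             = ⟪ 5 , encode f ⟫
encode* []                = 0
encode* (g ∷ gs)          = ⟪ encode g , encode* gs ⟫

opaque
  unfolding ⟪_,_⟫

  a≤⟪a,b⟫ : ∀ a b → a ≤ ⟪ a , b ⟫
  a≤⟪a,b⟫ a b = m≤n+m a (tri (a + b))

  n≤tri : ∀ n → n ≤ tri n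
  n≤tri zero    = z≤n
  n≤tri (suc n) = m≤m+n (suc n) (tri n)

  b≤⟪a,b⟫ : ∀ a b → b ≤ ⟪ a , b ⟫
  b≤⟪a,b⟫ a b = ≤-trans (m≤n+m b a) (≤-trans (n≤tri (a + b)) (m≤m+n (tri (a + b)) a))

  -- Strict because of the positive tag. Composite terms have tags 3 to 5, so this pays for the unit
  -- of fuel spent on each constructor.
  b<⟪1+a,b⟫ : ∀ a b → b < ⟪ suc a , b ⟫
  b<⟪1+a,b⟫ a b = ≤-trans (s≤s (m≤n+m b a)) (≤-trans (n≤tri (suc a + b)) (m≤m+n (tri (suc a + b)) (suc a)))

  decode-encode-fuel  : ∀ {n} fu (t : PR n) → encode t < fu → decodeF fu n (encode t) ≡ t
  decode-encode-fuel* : ∀ {m n} fu (ts : Vec (PR n) m) → encode* ts < fu → decodeVecF fu n m (encode* ts) ≡ ts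
  decode-encode-fuel (suc fu) Z lt = refl
  decode-encode-fuel (suc fu) S lt = refl
  decode-encode-fuel {n} (suc fu) (P i) lt rewrite unpair-pair 2 (toℕ i) with toℕ i <? n
  ... | yes i<n = cong P (fromℕ<-toℕ i i<n)
  ... | no  i≮n = contradiction (toℕ<n i) i≮n
  decode-encode-fuel {n} (suc fu) (Comp {m} f gs) (s≤s lt)
    rewrite unpair-pair 3 ⟪ m , ⟪ encode f , encode* gs ⟫ ⟫
          | unpair-pair m ⟪ encode f , encode* gs ⟫
          | unpair-pair (encode f) (encode* gs) =
    cong₂ Comp (decode-encode-fuel fu f (≤-<-trans (a≤⟪a,b⟫ _ _) lt′))
               (decode-encode-fuel* fu gs (≤-<-trans (b≤⟪a,b⟫ (encode f) _) lt′))
    where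
    lt′ : ⟪ encode f , encode* gs ⟫ < fu
    lt′ = ≤-<-trans (b≤⟪a,b⟫ m _) (<-≤-trans (b<⟪1+a,b⟫ 2 ⟪ m , ⟪ encode f , encode* gs ⟫ ⟫) lt)
  decode-encode-fuel (suc fu) (Rec f g) (s≤s lt)
    rewrite unpair-pair 4 ⟪ encode f , encode g ⟫ | unpair-pair (encode f) (encode g) =
    cong₂ Rec (decode-encode-fuel fu f (≤-<-trans (a≤⟪a,b⟫ _ _) lt′))
              (decode-encode-fuel fu g (≤-<-trans (b≤⟪a,b⟫ (encode f) _) lt′))
    where
    lt′ : ⟪ encode f , encode g ⟫ < fu
    lt′ = <-≤-trans (b<⟪1+a,b⟫ 3 ⟪ encode f , encode g ⟫) lt
  decode-encode-fuel (suc fu) (Mu f) (s≤s lt) rewrite unpair-pair 5 (encode f) =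
    cong Mu (decode-encode-fuel fu f (<-≤-trans (b<⟪1+a,b⟫ 4 (encode f)) lt))
  decode-encode-fuel* fu [] lt = refl
  decode-encode-fuel* fu (t ∷ ts) lt rewrite unpair-pair (encode t) (encode* ts) =
    cong₂ _∷_ (decode-encode-fuel fu t (≤-<-trans (a≤⟪a,b⟫ _ _) lt))
              (decode-encode-fuel* fu ts (≤-<-trans (b≤⟪a,b⟫ (encode t) _) lt))

decode-encode : ∀ {n} (t : PR n) → decode n (encode t) ≡ t
decode-encode t = decode-encode-fuel (suc (encode t)) t ≤-refl

⇓⇒φ : ∀ (t : PR 1) {x y} → t [ x ∷ [] ]⇓ y → φ (encode t) x y
⇓⇒φ t {x} {y} = subst (_[ x ∷ [] ]⇓ y) (sym (decode-encode t))

-- The diagonalising languages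

-- Here `p` is the current hypothesis and `q` the one after the datum. Selecting `x = 0`
-- unconditionally makes every language nonempty, hence different from the set of the initial
-- hypothesis.
accept : ℕ → ℕ → ℕ → ℕ
accept x q p = ifz x 1 (differ q p)

infix 5 _∪_∋_
-- The shift by one lets `k = 0` mean that nothing is added.
_∪_∋_ : (ℕ → ℕ) → ℕ → ℕ → ℕ
w ∪ k ∋ x = ifz (differ (suc x) k) 1 (w x)

datumInput pauseInput acceptP : Prim 3
datumInput = sucᵖ (var (# 1) ,ᵖ sucᵖ (var (# 2) ,ᵖ var (# 0)))
pauseInput = sucᵖ (var (# 1) ,ᵖ num 0)
acceptP    = ifP (var (# 0)) (num 1) (call differP (var (# 1) ∷ var (# 2) ∷ []))

indicatorP : Prim 4
indicatorP = ifP (call differP (fstᵖ (var (# 2)) ∷ var (# 0) ∷ []))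
                 (ifP (call differP (sucᵖ (sndᵖ (var (# 2))) ∷ var (# 1) ∷ [])) (num 1) (var (# 3)))
                 (num 0)

onDatumT onPauseT acceptedT nextT : PR 3
onDatumT  = Comp universal (P (# 2) ∷ term datumInput ∷ [])
onPauseT  = Comp universal (P (# 2) ∷ term pauseInput ∷ [])
acceptedT = Comp (term acceptP) (P (# 0) ∷ onDatumT ∷ P (# 1) ∷ [])
nextT     = Comp (term ifzP) (acceptedT ∷ onPauseT ∷ onDatumT ∷ [])

hypT selectedT : PR 2
hypT      = Rec (Comp universal (P (# 0) ∷ Z ∷ [])) nextT
selectedT = Comp acceptedT (P (# 0) ∷ hypT ∷ P (# 1) ∷ [])

opaque
  languageT : PR 3
  languageT = Comp (term indicatorP)
    (P (# 0) ∷ P (# 1) ∷ P (# 2) ∷ Comp selectedT (term (sndᵖ {3} (var (# 2))) ∷ P (# 0) ∷ []) ∷ [])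

-- The s-m-n construction for `languageT`, with both parameters inserted as numerals.
specialise : ℕ → ℕ → PR 1
specialise e k = Comp languageT (numeral e ∷ numeral k ∷ P (# 0) ∷ [])

-- The number `e` is a code for `universal`, not an index of the numbering. Totality of `f` makes
-- selection decidable.
module Diagonal (e : ℕ) (f : ℕ → ℕ) (f-⇓ : ∀ x → universal [ e ∷ x ∷ [] ]⇓ f x) where

  onDatum : ℕ → ℕ → ℕ
  onDatum p x = f (suc ⟪ p , suc ⟪ e , x ⟫ ⟫)

  onPause : ℕ → ℕ
  onPause p = f (suc ⟪ p , 0 ⟫)

  hyp : ℕ → ℕ
  hyp zero    = f 0
  hyp (suc x) = ifz (accept x (onDatum (hyp x) x) (hyp x)) (onPause (hyp x)) (onDatum (hyp x) x)

  selected : ℕ → ℕ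
  selected x = accept x (onDatum (hyp x) x) (hyp x)

  -- The selected elements ⟪ e , x ⟫ and, if k = suc z, the possibly unselected ⟪ e , z ⟫.
  language : ℕ → ℕ → ℕ
  language k y = ifz (differ (π₁ y) e) (selected ∪ k ∋ π₂ y) 0

  onDatum-⇓ : ∀ x p → onDatumT [ x ∷ p ∷ e ∷ [] ]⇓ onDatum p x
  onDatum-⇓ x p = evComp (ev∷ evP (ev∷ (computes datumInput _) ev[])) (f-⇓ _)

  accepted-⇓ : ∀ x p → acceptedT [ x ∷ p ∷ e ∷ [] ]⇓ accept x (onDatum p x) p
  accepted-⇓ x p = evComp (ev∷ evP (ev∷ (onDatum-⇓ x p) (ev∷ evP ev[]))) (computes acceptP _)

  hyp-⇓ : ∀ x → hypT [ x ∷ e ∷ [] ]⇓ hyp x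
  hyp-⇓ zero    = evRec0 (evComp (ev∷ evP (ev∷ evZ ev[])) (f-⇓ 0))
  hyp-⇓ (suc x) = evRecS (hyp-⇓ x)
    (evComp (ev∷ (accepted-⇓ x _) (ev∷ onPause-⇓ (ev∷ (onDatum-⇓ x _) ev[]))) (computes ifzP _))
    where
    onPause-⇓ : onPauseT [ x ∷ hyp x ∷ e ∷ [] ]⇓ onPause (hyp x)
    onPause-⇓ = evComp (ev∷ evP (ev∷ (computes pauseInput _) ev[])) (f-⇓ _)

  selected-⇓ : ∀ x → selectedT [ x ∷ e ∷ [] ]⇓ selected x
  selected-⇓ x = evComp (ev∷ evP (ev∷ (hyp-⇓ x) (ev∷ evP ev[]))) (accepted-⇓ x _)

  opaque
    unfolding languageT

    language-⇓ : ∀ k y → languageT [ e ∷ k ∷ y ∷ [] ]⇓ language k y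
    language-⇓ k y = evComp
      (ev∷ evP (ev∷ evP (ev∷ evP (ev∷
        (evComp (ev∷ (computes (sndᵖ (var (# 2))) _) (ev∷ evP ev[])) (selected-⇓ (π₂ y))) ev[]))))
      (computes indicatorP _)

  specialise-⇓ : ∀ k y → specialise e k [ y ∷ [] ]⇓ language k y
  specialise-⇓ k y = evComp (ev∷ (numeral-⇓ e _) (ev∷ (numeral-⇓ k _) (ev∷ evP ev[]))) (language-⇓ k y)

  selected-bit : ∀ x → selected x ≡ 0 ⊎ selected x ≡ 1
  selected-bit zero    = inj₂ refl
  selected-bit (suc x) = differ-bit (onDatum (hyp (suc x)) (suc x)) (hyp (suc x))

  ∪-bit : ∀ k x → selected ∪ k ∋ x ≡ 0 ⊎ selected ∪ k ∋ x ≡ 1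
  ∪-bit k x with differ (suc x) k
  ... | zero  = inj₂ refl
  ... | suc _ = selected-bit x

  language≤1 : ∀ k y → language k y ≤ 1
  language≤1 k y with differ (π₁ y) e
  ... | suc _ = z≤n
  ... | zero  with ∪-bit k (π₂ y)
  ...   | inj₁ eq rewrite eq = z≤n
  ...   | inj₂ eq rewrite eq = s≤s z≤n

  language-datum : ∀ k x → language k ⟪ e , x ⟫ ≡ selected ∪ k ∋ x
  language-datum k x rewrite π₁-⟪⟫ e x | π₂-⟪⟫ e x | differ-refl e = refl

  language⇒datum : ∀ k y → language k y ≡ 1 → ∃ λ x → y ≡ ⟪ e , x ⟫ × selected ∪ k ∋ x ≡ 1
  language⇒datum k y eq with differ (π₁ y) e in e≡
  ... | zero = π₂ y , trans (sym (⟪π₁,π₂⟫ y)) (cong ⟪_, π₂ y ⟫ (differ≡0⇒≡ (π₁ y) e e≡)) , eq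

  first∈language : ∀ k → language k ⟪ e , 0 ⟫ ≡ 1
  first∈language k = trans (language-datum k 0) first
    where
    first : selected ∪ k ∋ 0 ≡ 1
    first with differ 1 k
    ... | zero  = refl
    ... | suc _ = refl

  extra∈language : ∀ x → language (suc x) ⟪ e , x ⟫ ≡ 1
  extra∈language x = trans (language-datum (suc x) x) extra
    where
    extra : selected ∪ suc x ∋ x ≡ 1
    extra rewrite differ-refl x = refl

  -- This is why a single unselected datum reveals the whole language.
  unselected⇒extra : ∀ k x → selected ∪ k ∋ x ≡ 1 → selected x ≡ 0 → suc x ≡ k
  unselected⇒extra k x eq sel with differ (suc x) k in d
  ... | zero  = differ≡0⇒≡ (suc x) k d
  ... | suc _ = contradiction (trans (sym sel) eq) 0≢1+n

  data Proper : ℕ → Set where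
    none  : Proper 0
    extra : ∀ x → selected x ≡ 0 → Proper (suc x)

  -- Adding an element that is selected anyway changes nothing, so `k` may be replaced by 0. The
  -- learner would never reach the index for such a `k`, as no unselected datum announces it.
  properIndex : ∀ k → ∃ λ k′ → Proper k′ × (∀ y → language k y ≡ language k′ y)
  properIndex zero    = 0 , none , λ y → refl
  properIndex (suc x) with selected-bit x
  ... | inj₁ sel = suc x , extra x sel , λ y → refl
  ... | inj₂ sel = 0 , none , λ y → cong (λ z → ifz (differ (π₁ y) e) z 0) (absorb (π₂ y))
    where
    absorb : ∀ z → selected ∪ suc x ∋ z ≡ selected ∪ 0 ∋ z
    absorb z with differ z x in d
    ... | zero  rewrite differ≡0⇒≡ z x d = sym sel
    ... | suc _ = refl

-- The learner of the separating class

numeralCode : ℕ → ℕ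
numeralCode k = encode (numeral {1} k)

numeralCodeP : Prim 1
numeralCodeP = prim₁ numeralCode (Rec (term base) (term extend)) ev
  where
  base : Prim 0
  base = num 0 ,ᵖ num 0
  extend : Prim 2
  extend = num 3 ,ᵖ num 1 ,ᵖ num (encode S) ,ᵖ var (# 1) ,ᵖ num 0
  ev : ∀ k → Rec (term base) (term extend) [ k ∷ [] ]⇓ numeralCode k
  ev zero    = evRec0 (computes base [])
  ev (suc k) = evRecS (ev k) (computes extend (k ∷ numeralCode k ∷ []))

-- Mirrors `encode` on `specialise e k`, so that the learner can compute its hypotheses from `e` and
-- `k`.
specialiseCodeP : Prim 2
specialiseCodeP =
  num 3 ,ᵖ num 3 ,ᵖ num (encode languageT) ,ᵖ
  call numeralCodeP (var (# 0) ∷ []) ,ᵖ call numeralCodeP (var (# 1) ∷ []) ,ᵖ num (encode (P {1} (# 0))) ,ᵖ num 0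

module Separation (ψ : Numbering) (acc : Acceptable ψ) where
  open Learning ψ
  open Acceptable acc

  ψ-deterministic : ∀ {e x y z} → ψ e x y → ψ e x z → y ≡ z
  ψ-deterministic {e} {x} {y} {z} p q = ⇓-deterministic (proj₁ (to-spec e x y) p) (proj₁ (to-spec e x z) q)

  It-deterministic : ∀ {h T i p q} → It h T i p → It h T i q → p ≡ q
  It-deterministic (it0 a) (it0 b) = ψ-deterministic a b
  It-deterministic (itS i a) (itS j b) with refl ← It-deterministic i j = ψ-deterministic a b

  ⇓⇒ψ : ∀ (t : PR 1) {x y} → t [ x ∷ [] ]⇓ y → ψ (from (encode t)) x y
  ⇓⇒ψ t {x} {y} d = proj₁ (from-spec (encode t) x y) (⇓⇒φ t d)

  -- `Prim` asks only for a total function with a term that computes it, so the recursive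
  -- translation `from` fits as well.
  fromP : Prim 1
  fromP = prim₁ from (decode 1 (proj₁ from-comp)) (proj₂ from-comp)

  ∅-index : ℕ
  ∅-index = from (encode (Z {1}))

  index : ℕ → ℕ → ℕ
  index e k = from (encode (specialise e k))

  -- A selected datum replaces only the initial hypothesis: a later one may record the extra
  -- element, which an iterative learner could not recover.
  update : ℕ → ℕ → ℕ → ℕ → ℕ
  update w p e x = ifz w (index e (suc x)) (ifz (differ p ∅-index) (index e 0) p)

  updateP : Prim 4
  updateP = ifP (var (# 0)) (indexP (sucᵖ (var (# 3))))
    (ifP (call differP (var (# 1) ∷ num ∅-index ∷ [])) (indexP (num 0)) (var (# 1)))
    where
    indexP : Prim 4 → Prim 4
    indexP k = call fromP (call specialiseCodeP (var (# 2) ∷ k ∷ []) ∷ [])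

  oldHyp datum : Prim n → Prim n
  oldHyp i = fstᵖ (call predP (i ∷ []))
  datum  i = sndᵖ (call predP (i ∷ []))

  -- For a datum `⟪ e , x ⟫` these are the program `e` and the position `x`; `pred` removes the
  -- shift that separates data from pauses.
  column row : Prim n → Prim n
  column i = fstᵖ (call predP (datum i ∷ []))
  row    i = sndᵖ (call predP (datum i ∷ []))

  isDatum withoutDatum : Prim 1
  isDatum      = ifP (datum (var (# 0))) (num 0) (num 1)
  withoutDatum = ifP (var (# 0)) (num ∅-index) (oldHyp (var (# 0)))

  withDatum : PR 3
  withDatum = Comp (term updateP)
    ( Comp selectedT (term (row i) ∷ term (column i) ∷ [])
    ∷ term (oldHyp i) ∷ term (column i) ∷ term (row i) ∷ [])
    where
    i : Prim 3
    i = var (# 2)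

  -- Rec on isDatum is a lazy case distinction: selectedT may diverge on the components of a pause.
  learner : PR 1
  learner = Comp (Rec (term withoutDatum) withDatum) (term isDatum ∷ P (# 0) ∷ [])

  learner-start : learner [ 0 ∷ [] ]⇓ ∅-index
  learner-start = evComp (ev∷ (evaluates isDatum no-datum) (ev∷ evP ev[])) (evRec0 (computes withoutDatum _))
    where
    no-datum : ⟦ isDatum ⟧ (0 ∷ []) ≡ 0
    -- The empty sequence has input 0, whose second component decodes to 0 like that of a pause;
    -- `withoutDatum` separates the two.
    no-datum rewrite π₂-0 = refl

  learner-pause : ∀ p → learner [ suc ⟪ p , 0 ⟫ ∷ [] ]⇓ p
  learner-pause p = evComp (ev∷ (evaluates isDatum no-datum) (ev∷ evP ev[]))
                           (evRec0 (evaluates withoutDatum (π₁-⟪⟫ p 0)))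
    where
    no-datum : ⟦ isDatum ⟧ (suc ⟪ p , 0 ⟫ ∷ []) ≡ 0
    no-datum rewrite π₂-⟪⟫ p 0 = refl

  -- Convergence of the learner on the languages of one program

  module Correctness (e : ℕ) (f : ℕ → ℕ) (f-⇓ : ∀ x → universal [ e ∷ x ∷ [] ]⇓ f x) where
    open Diagonal e f f-⇓

    learner-datum : ∀ p x → learner [ suc ⟪ p , suc ⟪ e , x ⟫ ⟫ ∷ [] ]⇓ update (selected x) p e x
    learner-datum p x = evComp (ev∷ (evaluates isDatum is-datum) (ev∷ evP ev[]))
      (evRecS (evRec0 (computes withoutDatum _))
        (evComp (ev∷ (evComp (ev∷ row-⇓ (ev∷ column-⇓ ev[])) (selected-⇓ x))
                (ev∷ (evaluates (oldHyp (var (# 2))) (π₁-⟪⟫ p _))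
                (ev∷ column-⇓ (ev∷ row-⇓ ev[]))))
                (computes updateP _)))
      where
      i = suc ⟪ p , suc ⟪ e , x ⟫ ⟫
      is-datum : ⟦ isDatum ⟧ (i ∷ []) ≡ 1
      is-datum rewrite π₂-⟪⟫ p (suc ⟪ e , x ⟫) = refl
      column-⇓ : ∀ {xs} → term (column {3} (var (# 2))) [ 0 ∷ xs ∷ i ∷ [] ]⇓ e
      column-⇓ = evaluates (column (var (# 2))) (trans (cong (λ z → π₁ (pred z)) (π₂-⟪⟫ p _)) (π₁-⟪⟫ e x))
      row-⇓ : ∀ {xs} → term (row {3} (var (# 2))) [ 0 ∷ xs ∷ i ∷ [] ]⇓ x
      row-⇓ = evaluates (row (var (# 2))) (trans (cong (λ z → π₂ (pred z)) (π₂-⟪⟫ p _)) (π₂-⟪⟫ e x))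

    ψ-index : ∀ k y → ψ (index e k) y (language k y)
    ψ-index k y = ⇓⇒ψ (specialise e k) (specialise-⇓ k y)

    index-CIndex : ∀ k → CIndex (index e k)
    index-CIndex k y = language k y , ψ-index k y , language≤1 k y

    ∅-CIndex : CIndex ∅-index
    ∅-CIndex y = 0 , ⇓⇒ψ Z evZ , z≤n

    language⇒C : ∀ k y → language k y ≡ 1 → C (index e k) y
    language⇒C k y eq = subst (ψ (index e k) y) eq (ψ-index k y)

    C⇒language : ∀ k y → C (index e k) y → language k y ≡ 1
    C⇒language k y c = ψ-deterministic (ψ-index k y) c

    -- The sets differ at `⟪ e , 0 ⟫`. Hence the comparison of indices in `update` never takes a
    -- later hypothesis for the initial one.
    index≢∅-index : ∀ k → index e k ≢ ∅-index
    index≢∅-index k eq = contradiction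
      (ψ-deterministic (⇓⇒ψ Z evZ) (subst (λ i → C i ⟪ e , 0 ⟫) eq (language⇒C k _ (first∈language k)))) 0≢1+n

    update-selected : ∀ j x → selected x ≡ 1 → update (selected x) (index e j) e x ≡ index e j
    update-selected j x sel rewrite sel =
      cong (λ c → ifz c (index e 0) (index e j)) (≢⇒differ≡1 (index e j) ∅-index (index≢∅-index j))

    update-first : ∀ x → selected x ≡ 1 → update (selected x) ∅-index e x ≡ index e 0
    update-first x sel rewrite sel | differ-refl ∅-index = refl

    update-unselected : ∀ p x → selected x ≡ 0 → update (selected x) p e x ≡ index e (suc x)
    update-unselected p x sel rewrite sel = refl

    module _ (k : ℕ) where

      -- The invariant of a run on a text for the language with proper parameter `k`; as all three
      -- are C-indices, it yields `CInd`.
      data Possible : ℕ → Set where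
        initial : Possible ∅-index
        base    : Possible (index e 0)
        final   : Possible (index e k)

      update-possible : ∀ {p} x → selected ∪ k ∋ x ≡ 1 → Possible p → Possible (update (selected x) p e x)
      update-possible x x∈ poss with selected-bit x
      update-possible {p} x x∈ poss | inj₁ sel =
        subst Possible (sym (trans (update-unselected p x sel) (cong (index e) (unselected⇒extra k x x∈ sel)))) final
      update-possible x x∈ initial | inj₂ sel = subst Possible (sym (update-first x sel)) base
      update-possible x x∈ base    | inj₂ sel = subst Possible (sym (update-selected 0 x sel)) base
      update-possible x x∈ final   | inj₂ sel = subst Possible (sym (update-selected k x sel)) final

      update-final : ∀ x → selected ∪ k ∋ x ≡ 1 → update (selected x) (index e k) e x ≡ index e k
      update-final x x∈ with selected-bit x
      ... | inj₂ sel = update-selected k x sel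
      ... | inj₁ sel = trans (update-unselected (index e k) x sel) (cong (index e) (unselected⇒extra k x x∈ sel))

      Possible-CIndex : ∀ {p} → Possible p → CIndex p
      Possible-CIndex initial = ∅-CIndex
      Possible-CIndex base    = index-CIndex 0
      Possible-CIndex final   = index-CIndex k

    -- The position of a datum that forces the final hypothesis from any possible one: the extra
    -- element if there is one, otherwise `⟪ e , 0 ⟫`, which always belongs to the language.
    decisive : ∀ {k} → Proper k → ℕ
    decisive none        = 0
    decisive (extra x _) = x

    decisive∈language : ∀ {k} (pr : Proper k) → language k ⟪ e , decisive pr ⟫ ≡ 1
    decisive∈language none        = first∈language 0
    decisive∈language (extra x _) = extra∈language x

    update-decisive : ∀ {k p} (pr : Proper k) → Possible k p →
      update (selected (decisive pr)) p e (decisive pr) ≡ index e k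
    update-decisive {p = p} (extra x sel) _ = update-unselected p x sel
    update-decisive none initial = update-first 0 refl
    update-decisive none base    = update-selected 0 0 refl
    update-decisive none final   = update-selected 0 0 refl

    module OnText {k} (pr : Proper k) (T : Text)
      (sound : ∀ i y → T i ≡ just y → language k y ≡ 1)
      (i₀ : ℕ) (decisive-seen : T i₀ ≡ just ⟪ e , decisive pr ⟫) where

      -- Describes the learner on this text only: soundness gives every datum the first component
      -- `e`.
      react : ℕ → Maybe ℕ → ℕ
      react p nothing  = p
      react p (just y) = update (selected (π₂ y)) p e (π₂ y)

      react-datum : ∀ p x → react p (just ⟪ e , x ⟫) ≡ update (selected x) p e x
      react-datum p x rewrite π₂-⟪⟫ e x = refl

      trajectory : ℕ → ℕ
      trajectory zero    = ∅-index
      trajectory (suc i) = react (trajectory i) (T i)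

      ψ-learner : ∀ p i → ψ (from (encode learner)) (suc (pair p (codeIn (T i)))) (react p (T i))
      ψ-learner p i with T i in Ti
      ... | nothing = ⇓⇒ψ learner (subst (λ z → learner [ suc z ∷ [] ]⇓ p) (⟪⟫≡pair p 0) (learner-pause p))
      ... | just y  with language⇒datum k y (sound i y Ti)
      ...   | x , refl , _ = ⇓⇒ψ learner
        (subst₂ (λ z q → learner [ suc z ∷ [] ]⇓ q) (⟪⟫≡pair p (suc ⟪ e , x ⟫)) (sym (react-datum p x)) (learner-datum p x))

      It-trajectory : ∀ i → It (from (encode learner)) T i (trajectory i)
      It-trajectory zero    = it0 (⇓⇒ψ learner learner-start)
      It-trajectory (suc i) = itS (It-trajectory i) (ψ-learner (trajectory i) i)

      react-possible : ∀ {p} i → Possible k p → Possible k (react p (T i))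
      react-possible {p} i poss with T i in Ti
      ... | nothing = poss
      ... | just y  with language⇒datum k y (sound i y Ti)
      ...   | x , refl , x∈ = subst (Possible k) (sym (react-datum p x)) (update-possible k x x∈ poss)

      react-final : ∀ i → react (index e k) (T i) ≡ index e k
      react-final i with T i in Ti
      ... | nothing = refl
      ... | just y  with language⇒datum k y (sound i y Ti)
      ...   | x , refl , x∈ = trans (react-datum (index e k) x) (update-final k x x∈)

      trajectory-possible : ∀ i → Possible k (trajectory i)
      trajectory-possible zero    = initial
      trajectory-possible (suc i) = react-possible i (trajectory-possible i)

      converged : ∀ d → trajectory (d + suc i₀) ≡ index e k
      converged zero    = trans (cong (react (trajectory i₀)) decisive-seen)
        (trans (react-datum (trajectory i₀) (decisive pr)) (update-decisive pr (trajectory-possible i₀)))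
      converged (suc d) = trans (cong (λ p → react p (T (d + suc i₀))) (converged d)) (react-final (d + suc i₀))

      learned : (∀ y → language k y ≡ 1 → content T y) → ItCIndExC (from (encode learner)) T
      learned complete =
        (λ i → trajectory i , It-trajectory i , Possible-CIndex k (trajectory-possible i)) ,
        suc i₀ , index e k ,
        (λ n i₀<n → subst (It _ T n)
          (subst (λ z → trajectory z ≡ index e k) (m∸n+n≡m i₀<n) (converged (n ∸ suc i₀))) (It-trajectory n)) ,
        index-CIndex k ,
        λ y → (λ { (i , Ti) → language⇒C k y (sound i y Ti) }) , λ c → complete y (C⇒language k y c)

  -- The separating class

  separating : Class
  separating L = Σ ℕ λ e → Σ (ℕ → ℕ) λ f → Σ (∀ x → universal [ e ∷ x ∷ [] ]⇓ f x) λ f-⇓ → Σ ℕ λ k →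
    ∀ y → (L y → Diagonal.language e f f-⇓ k y ≡ 1) × (Diagonal.language e f f-⇓ k y ≡ 1 → L y)

  separating⊆REC : separating ⊆REC
  separating⊆REC L (e , f , f-⇓ , k , L⇔) = index e k , index-CIndex k ,
    λ y → (λ Ly → language⇒C k y (proj₁ (L⇔ y) Ly)) , (λ c → proj₂ (L⇔ y) (C⇒language k y c))
    where open Correctness e f f-⇓

  separating-learned : ∀ L → separating L → Learns (from (encode learner)) L
  separating-learned L (e , f , f-⇓ , k , L⇔) T text with Diagonal.properIndex e f f-⇓ k
  ... | k′ , pr , same = OnText.learned pr T sound (proj₁ seen) (proj₂ seen) complete
    where
    open Diagonal e f f-⇓
    open Correctness e f f-⇓
    sound : ∀ i y → T i ≡ just y → language k′ y ≡ 1
    sound i y Ti = trans (sym (same y)) (proj₁ (L⇔ y) (proj₂ (text y) (i , Ti)))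
    complete : ∀ y → language k′ y ≡ 1 → content T y
    complete y y∈ = proj₁ (text y) (proj₂ (L⇔ y) (trans (same y) y∈))
    seen : content T ⟪ e , decisive pr ⟫
    seen = complete _ (decisive∈language pr)

  -- Refutation of a total learner

  module Refutation (h : ℕ) (total : Total h) (learns : ∀ L → separating L → Learns h L) where

    f : ℕ → ℕ
    f x = proj₁ (total x)

    program : PR 1
    program = decode 1 (to h)

    -- The machine code of `h` itself: the class contains the languages diagonalising against it.
    e : ℕ
    e = compile program

    f-⇓ : ∀ x → universal [ e ∷ x ∷ [] ]⇓ f x
    f-⇓ x = universal-complete program (proj₁ (to-spec h x (f x)) (proj₂ (total x)))

    open Diagonal e f f-⇓
    open Correctness e f f-⇓

    L : ℕ → Pred ℕ _
    L k y = language k y ≡ 1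

    -- The canonical text for L (suc z) with unselected z differs from that for L 0 only at
    -- position z, where it has ⟪ e , z ⟫ instead of a pause.
    text : ℕ → Text
    text k x = ifz (selected ∪ k ∋ x) nothing (just ⟪ e , x ⟫)

    text-TextFor : ∀ k → TextFor (text k) (L k)
    text-TextFor k y = complete , sound
      where
      complete : L k y → content (text k) y
      complete y∈ with language⇒datum k y y∈
      ... | x , refl , x∈ = x , cong (λ c → ifz c nothing (just ⟪ e , x ⟫)) x∈
      sound : content (text k) y → L k y
      sound (x , eq) with selected ∪ k ∋ x in x∈
      sound (x , ())   | zero
      sound (x , refl) | suc w with ∪-bit k x
      ... | inj₁ x∉ = contradiction (trans (sym x∉) x∈) 0≢1+n
      ... | inj₂ x∈′ = trans (language-datum k x) x∈′

    text-learned : ∀ k → ItCIndExC h (text k)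
    text-learned k = learns (L k) (e , f , f-⇓ , k , λ y → (λ y∈ → y∈) , (λ y∈ → y∈)) (text k) (text-TextFor k)

    time limit : ℕ → ℕ
    time k  = proj₁ (proj₂ (text-learned k))
    limit k = proj₁ (proj₂ (proj₂ (text-learned k)))

    converges : ∀ k n → time k ≤ n → It h (text k) n (limit k)
    converges k = proj₁ (proj₂ (proj₂ (proj₂ (text-learned k))))

    L⇒limit : ∀ k y → L k y → C (limit k) y
    L⇒limit k y y∈ = proj₁ (proj₂ (proj₂ (proj₂ (proj₂ (proj₂ (text-learned k))))) y) (proj₁ (text-TextFor k y) y∈)

    limit⇒L : ∀ k y → C (limit k) y → L k y
    limit⇒L k y c = proj₂ (text-TextFor k y) (proj₂ (proj₂ (proj₂ (proj₂ (proj₂ (proj₂ (text-learned k))))) y) c)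

    on-datum : ∀ p x → ψ h (suc (pair p (suc ⟪ e , x ⟫))) (onDatum p x)
    on-datum p x = subst (λ z → ψ h (suc z) (onDatum p x)) (⟪⟫≡pair p (suc ⟪ e , x ⟫)) (proj₂ (total _))

    on-pause : ∀ p → ψ h (suc (pair p 0)) (onPause p)
    on-pause p = subst (λ z → ψ h (suc z) (onPause p)) (⟪⟫≡pair p 0) (proj₂ (total _))

    -- The left alternative is a position that the extra element leaves alone. The right one is a
    -- position holding a datum that leads to the hypothesis `hyp (suc i)` all the same.
    It-step : ∀ k i → (selected ∪ k ∋ i ≡ selected i ⊎ (onDatum (hyp i) i ≡ hyp (suc i) × selected ∪ k ∋ i ≡ 1)) →
      ψ h (suc (pair (hyp i) (codeIn (text k i)))) (hyp (suc i))
    It-step k i (inj₁ eq) rewrite eq with selected i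
    ... | zero  = on-pause (hyp i)
    ... | suc _ = on-datum (hyp i) i
    It-step k i (inj₂ (keep , eq)) rewrite eq = subst (ψ h _) keep (on-datum (hyp i) i)

    It-hyp : ∀ i → It h (text 0) i (hyp i)
    It-hyp zero    = it0 (proj₂ (total 0))
    It-hyp (suc i) = itS (It-hyp i) (It-step 0 i (inj₁ refl))

    hyp-limit : ∀ n → time 0 ≤ n → hyp n ≡ limit 0
    hyp-limit n t≤n = It-deterministic (It-hyp n) (converges 0 n t≤n)

    -- Any z ≥ time 0 other than 0, which is always selected.
    z : ℕ
    z = suc (time 0)

    z-fixed : hyp (suc z) ≡ hyp z
    z-fixed = trans (hyp-limit (suc z) (m≤n+m (time 0) 2)) (sym (hyp-limit z (n≤1+n (time 0))))

    -- As `z` is positive, its selection would mean that the datum changes the hypothesis, against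
    -- convergence before `z`.
    z-unselected : selected z ≡ 0
    z-unselected with selected-bit z
    ... | inj₁ sel = sel
    ... | inj₂ sel = contradiction (trans (sym (trans (cong (λ p → differ p (hyp z)) changed) (differ-refl (hyp z)))) sel) 0≢1+n
      where
      changed : onDatum (hyp z) z ≡ hyp z
      changed = trans (sym (cong (λ c → ifz c (onPause (hyp z)) (onDatum (hyp z) z)) sel)) z-fixed

    -- At position `z` the datum keeps `hyp z` because it is unselected, and the pause keeps it
    -- because the run has converged. So both texts produce the same hypotheses.
    It-hyp′ : ∀ i → It h (text (suc z)) i (hyp i)
    It-hyp′ zero    = it0 (proj₂ (total 0))
    It-hyp′ (suc i) = itS (It-hyp′ i) (It-step (suc z) i agree)
      where
      agree : selected ∪ suc z ∋ i ≡ selected i ⊎ (onDatum (hyp i) i ≡ hyp (suc i) × selected ∪ suc z ∋ i ≡ 1)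
      agree with differ i z in d
      ... | suc _ = inj₁ refl
      ... | zero rewrite differ≡0⇒≡ i z d =
        inj₂ (trans (differ≡0⇒≡ _ (hyp z) z-unselected) (sym z-fixed) , refl)

    same-limit : limit (suc z) ≡ limit 0
    -- The sum of the two convergence times lies past both.
    same-limit = at (time 0 + time (suc z)) (m≤m+n (time 0) _) (m≤n+m _ (time 0))
      where
      at : ∀ i → time 0 ≤ i → time (suc z) ≤ i → limit (suc z) ≡ limit 0
      at i le le′ = trans (It-deterministic (converges (suc z) i le′) (It-hyp′ i)) (hyp-limit i le)

    -- The common limit describes both languages, and the larger one contains `⟪ e , z ⟫`; this
    -- contradicts `z-unselected`.
    z∈L : L 0 ⟪ e , z ⟫
    z∈L = limit⇒L 0 _ (subst (λ i → C i ⟪ e , z ⟫) same-limit (L⇒limit (suc z) _ (extra∈language z)))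

    absurd : ⊥
    absurd = 0≢1+n (trans (sym z-unselected) (trans (sym (language-datum 0 z)) z∈L))

theorem6 : (ψ : Numbering) → Acceptable ψ →
    let open Learning ψ in
    (∀ (𝓛 : Class) → InRTxtItCIndExC 𝓛 → InTxtItCIndExC 𝓛) ×
    (∃ λ (𝓛 : Class) → InTxtItCIndExC 𝓛 × ¬ InRTxtItCIndExC 𝓛)
theorem6 ψ acc =
  (λ { 𝓛 (𝓛⊆REC , h , _ , learns) → 𝓛⊆REC , h , learns }) ,
  separating , (separating⊆REC , from (encode learner) , separating-learned) ,
  λ { (_ , h , total , learns) → Refutation.absurd h total learns }
  where
  open Separation ψ acc
  open Acceptable acc
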